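{- Let $X$ be a finite set with $|X|\ge 4$ and let $\mathcal S$ be a split system on $X$. Then: (i) If $\mathcal S$ contains all 2-splits of $X$, then $\mathcal S$ is injective. (ii) If $\mathcal S$ is maximal circular, then $\mathcal S$ is injective.
   Context: Let $X$ be a finite set with $|X|\ge 3$. A split of $X$ is an unordered bipartition $A|B=B|A$ of $X$ into two non-empty disjoint subsets (its parts) with $A\cup B=X$. Its size is $\min\{|A|,|B|\}$; a split of size $r$ is called an $r$-split, and a split of size 1 is called trivial. A split system on $X$ is a set $\mathcal S$ of splits of $X$ that contains all trivial splits $\{x\}|X-\{x\}$, $x\in X$. For $S\in\mathcal S$ and $x\in X$, $S(x)$ denotes the part of $S$ containing $x$. The Buneman graph $\mathcal B(\mathcal S)$ has as vertices all maps $\phi:\mathcal S\to\mathcal P(X)$ such that (B1) $\phi(S)\in S$ (i.e. $\phi(S)$ is one of the two parts of $S$) for all $S\in\mathcal S$, and (B2) $\phi(S)\cap\phi(S')\ne\emptyset$ for all distinct $S,S'\in\mathcal S$. Two vertices $\phi,\phi'$ are adjacent if there is a unique $S\in\mathcal S$ with $\phi(S)\neq\phi'(S)$. For $x\in X$, $\phi_x$ denotes the vertex $S\mapsto S(x)$. It is known that $\mathcal B(\mathcal S)$ is a median graph, i.e. it is connected and any three vertices $u,v,w$ have a unique median (a vertex lying on shortest paths between each pair of $u,v,w$). For $Y=\{x,y,z\}\in\binom X3$ (the set of 3-element subsets of $X$), $\phi_Y$ denotes the median of $\phi_x,\phi_y,\phi_z$ in $\mathcal B(\mathcal S)$. The split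 system $\mathcal S$ is injective if $\phi_Y\ne\phi_{Y'}$ for all distinct $Y,Y'\in\binom X3$. A split system $\mathcal S$ on $X$, $n=|X|$, is circular if there is a labelling $x_1,\dots,x_n$ of the elements of $X$ such that every split in $\mathcal S$ is of the form $\{x_i,x_{i+1},\dots,x_j\}\,|\,X-\{x_i,x_{i+1},\dots,x_j\}$ for some $1\le i\le j\le n$. It is maximal circular if it is circular and there is no circular split system $\mathcal S'$ on $X$ with $\mathcal S\subsetneq\mathcal S'$. -}

module Defs where

open import Data.Fin using (Fin) renaming (_≤_ to _≤ᶠ_)
open import Data.Fin.Permutation using (Permutation′; _⟨$⟩ʳ_)
open import Data.Fin.Subset
  using (Subset; _∈_; _∩_; _∪_; ⊤; ⁅_⁆; ∣_∣; Nonempty; Empty)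
open import Data.Fin.Subset.Properties using (_∈?_; ∈⊤; x∈p∪q⁻; x∈p∩q⁺)
open import Data.Nat using (ℕ; zero; suc; _+_; _≤_; _⊓_)
open import Data.Product using (Σ; ∃; ∃₂; _×_; _,_; proj₁)
open import Data.Sum using (_⊎_; inj₁; inj₂)
open import Function.Bundles using (_⇔_)
open import Level using (0ℓ)
open import Relation.Binary.PropositionalEquality
  using (_≡_; _≢_; refl; sym; subst)
open import Relation.Nullary using (¬_; yes; no; contradiction)
open import Relation.Unary using (Pred; Decidable; _⊂_)

private
  variable
    n : ℕ

-- The ground set X with n elements is Fin n.

record Split (n : ℕ) : Set where
  field
    left right     : Subset n
    left-nonempty  : Nonempty left
    right-nonempty : Nonempty right
    disjoint       : Empty (left ∩ right)
    cover          : left ∪ right ≡ ⊤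

open Split public

-- Splits are unordered, A|B = B|A, so they are compared by _≈ˢ_
-- rather than by _≡_.
infix 4 _≈ˢ_
_≈ˢ_ : Split n → Split n → Set
S ≈ˢ S′ = (left S ≡ left S′  × right S ≡ right S′)
        ⊎ (left S ≡ right S′ × right S ≡ left S′)

infix 4 _PartOf_
_PartOf_ : Subset n → Split n → Set
A PartOf S = A ≡ left S ⊎ A ≡ right S

size : Split n → ℕ
size S = ∣ left S ∣ ⊓ ∣ right S ∣

infix 8 _⟦_⟧
_⟦_⟧ : Split n → Fin n → Subset n
S ⟦ x ⟧ with x ∈? left S
... | yes _ = left S
... | no  _ = right S

⟦⟧-part : (S : Split n) (x : Fin n) → S ⟦ x ⟧ PartOf S
⟦⟧-part S x with x ∈? left S
... | yes _ = inj₁ refl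
... | no  _ = inj₂ refl

∈⟦⟧ : (S : Split n) (x : Fin n) → x ∈ S ⟦ x ⟧
∈⟦⟧ S x with x ∈? left S
... | yes x∈l = x∈l
... | no  x∉l with x∈p∪q⁻ (left S) (right S) (subst (x ∈_) (sym (cover S)) ∈⊤)
...   | inj₁ x∈l = contradiction x∈l x∉l
...   | inj₂ x∈r = x∈r

⟦⟧-unique : (S : Split n) (x : Fin n) {A : Subset n} →
            A PartOf S → x ∈ A → A ≡ S ⟦ x ⟧
⟦⟧-unique S x A∈S x∈A with x ∈? left S | A∈S
... | yes _   | inj₁ A≡l  = A≡l
... | no  x∉l | inj₁ refl = contradiction x∈A x∉l
... | yes x∈l | inj₂ refl = contradiction (x , x∈p∩q⁺ (x∈l , x∈A)) (disjoint S)
... | no  _   | inj₂ A≡r  = A≡r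

PartOf-resp : {S S′ : Split n} {A : Subset n} → S ≈ˢ S′ → A PartOf S → A PartOf S′
PartOf-resp (inj₁ (refl , refl)) A∈S         = A∈S
PartOf-resp (inj₂ (refl , refl)) (inj₁ refl) = inj₂ refl
PartOf-resp (inj₂ (refl , refl)) (inj₂ refl) = inj₁ refl

⟦⟧-cong : {S S′ : Split n} (x : Fin n) → S ≈ˢ S′ → S ⟦ x ⟧ ≡ S′ ⟦ x ⟧
⟦⟧-cong {S = S} {S′} x S≈S′ =
  ⟦⟧-unique S′ x (PartOf-resp {S = S} {S′} S≈S′ (⟦⟧-part S x)) (∈⟦⟧ S x)

-- A set of splits is a decidable predicate invariant under _≈ˢ_.  As X is
-- finite, decidability is no restriction classically.
record SplitSystem (n : ℕ) : Set₁ where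
  field
    Member  : Pred (Split n) 0ℓ
    member? : Decidable Member
    resp    : ∀ {S S′} → S ≈ˢ S′ → Member S → Member S′
    trivial : ∀ S → size S ≡ 1 → Member S

open SplitSystem public

module Buneman {n : ℕ} (𝒮 : SplitSystem n) where

  Element : Set
  Element = ∃ (Member 𝒮)

  infix 4 _≈ᵉ_
  _≈ᵉ_ : Element → Element → Set
  S ≈ᵉ S′ = proj₁ S ≈ˢ proj₁ S′

  record Vertex : Set where
    field
      ϕ       : Element → Subset n
      ϕ-cong  : ∀ {S S′} → S ≈ᵉ S′ → ϕ S ≡ ϕ S′
      part    : ∀ S → ϕ S PartOf proj₁ S
      meets   : ∀ S S′ → ¬ S ≈ᵉ S′ → Nonempty (ϕ S ∩ ϕ S′)

  open Vertex public

  infix 4 _≈ᵛ_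
  _≈ᵛ_ : Vertex → Vertex → Set
  u ≈ᵛ v = ∀ S → ϕ u S ≡ ϕ v S

  Adjacent : Vertex → Vertex → Set
  Adjacent u v =
    ∃ λ S → ϕ u S ≢ ϕ v S × (∀ S′ → ϕ u S′ ≢ ϕ v S′ → S′ ≈ᵉ S)

  data Walk : ℕ → Vertex → Vertex → Set where
    stop : ∀ {u v} → u ≈ᵛ v → Walk zero u v
    step : ∀ {k u v w} → Adjacent u v → Walk k v w → Walk (suc k) u w

  -- A shortest u–v path through m is a walk from u to m followed by a walk
  -- from m to v whose total length is minimal among all u–v walks.
  OnShortestPath : Vertex → Vertex → Vertex → Set
  OnShortestPath u v m =
    ∃₂ λ k l → Walk k u m × Walk l m v × (∀ j → Walk j u v → k + l ≤ j)

  IsMedian : Vertex → Vertex → Vertex → Vertex → Set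
  IsMedian u v w m =
    OnShortestPath u v m × OnShortestPath v w m × OnShortestPath u w m

  IsUniqueMedian : Vertex → Vertex → Vertex → Vertex → Set
  IsUniqueMedian u v w m =
    IsMedian u v w m × (∀ m′ → IsMedian u v w m′ → m′ ≈ᵛ m)

  ϕ[_] : Fin n → Vertex
  ϕ[ x ] = record
    { ϕ       = λ S → proj₁ S ⟦ x ⟧
    ; ϕ-cong  = λ {S} {S′} → ⟦⟧-cong {S = proj₁ S} {proj₁ S′} x
    ; part    = λ S → ⟦⟧-part (proj₁ S) x
    ; meets   = λ S S′ _ → x , x∈p∩q⁺ (∈⟦⟧ (proj₁ S) x , ∈⟦⟧ (proj₁ S′) x)
    }

  -- m is the vertex ϕ_Y, for Y a 3-element set.
  IsMedianOf : Subset n → Vertex → Set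
  IsMedianOf Y m = Σ (Fin n) λ x → Σ (Fin n) λ y → Σ (Fin n) λ z →
    Y ≡ ⁅ x ⁆ ∪ ⁅ y ⁆ ∪ ⁅ z ⁆ × IsUniqueMedian ϕ[ x ] ϕ[ y ] ϕ[ z ] m

  -- ϕ_Y ≢ ϕ_Y′, with ϕ_Y and ϕ_Y′ read as definite descriptions: both medians
  -- exist, are unique, and differ.  Existence and uniqueness hold for every
  -- split system because Buneman graphs are median graphs.
  Injective : Set
  Injective = ∀ Y Y′ → ∣ Y ∣ ≡ 3 → ∣ Y′ ∣ ≡ 3 → Y ≢ Y′ →
    ∃₂ λ m m′ → IsMedianOf Y m × IsMedianOf Y′ m′ × ¬ (m ≈ᵛ m′)

open Buneman public using (Injective)

Contains2Splits : SplitSystem n → Set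
Contains2Splits 𝒮 = ∀ S → size S ≡ 2 → Member 𝒮 S

-- A = {x_i, …, x_j} for the labelling x_k = x ⟨$⟩ʳ k.
IsInterval : Permutation′ n → Fin n → Fin n → Subset n → Set
IsInterval x i j A = ∀ k → (x ⟨$⟩ʳ k) ∈ A ⇔ (i ≤ᶠ k × k ≤ᶠ j)

Circular : SplitSystem n → Set
Circular {n} 𝒮 = Σ (Permutation′ n) λ x →
  ∀ S → Member 𝒮 S →
  ∃₂ λ i j → i ≤ᶠ j × ∃ λ A → A PartOf S × IsInterval x i j A

MaximalCircular : SplitSystem n → Set₁
MaximalCircular {n} 𝒮 =
  Circular 𝒮 × ¬ (Σ (SplitSystem n) λ 𝒮′ → Circular 𝒮′ × Member 𝒮 ⊂ Member 𝒮′)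

{-# OPTIONS --safe #-}
module Submission where

-- The graph distance of two vertices of the Buneman graph is the number of splits on which they
-- differ.  Hence m lies on a shortest path between u and v exactly when it agrees with one of
-- them on every split, and the median of ϕ_x, ϕ_y, ϕ_z sends each split to the part containing
-- at least two of x, y, z.  So ϕ_Y and ϕ_Y′ differ as soon as a part of some split contains two
-- elements of Y and misses two elements of Y′.  For all 2-splits, such a part is a pair in Y with
-- a member outside Y′.  A maximal circular system contains every interval split, and an
-- interval spanned by two consecutive elements of Y or of Y′ separates them.

open import Defs
open import Data.Bool.Base using (if_then_else_)
open import Data.Bool.Properties using () renaming (_≟_ to _≟ᵇ_)
open import Data.Fin using (Fin; zero; suc) renaming (_≤_ to _≤ᶠ_; _<_ to _<ᶠ_; _≤?_ to _≤ᶠ?_)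
open import Data.Fin.Permutation
  using (Permutation′; _⟨$⟩ʳ_; _⟨$⟩ˡ_; inverseˡ; inverseʳ)
open import Data.Fin.Properties using (any?) renaming
  (_≟_ to _≟ᶠ_; <-cmp to <ᶠ-cmp; ≤-antisym to ≤ᶠ-antisym)
open import Data.Fin.Subset
open import Data.Fin.Subset.Properties
open import Data.List.Base using (List; []; _∷_; _++_; map; mapMaybe; filter; deduplicate)
open import Data.List.Extrema.Nat using (argmin; argmin-all; f[argmin]≤f[xs])
open import Data.List.Membership.Propositional using (lose) renaming (_∈_ to _∈ˡ_)
open import Data.List.Membership.Propositional.Properties
  using (∈-++⁺ˡ; ∈-++⁺ʳ; ∈-map⁺)
open import Data.List.Properties using (map-cong)
open import Data.List.Relation.Unary.All using (All; []; _∷_)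
import Data.List.Relation.Unary.All as All
open import Data.List.Relation.Unary.All.Properties using (all-filter)
open import Data.List.Relation.Unary.AllPairs using ([]; _∷_)
open import Data.List.Relation.Unary.Any using (Any; here; there)
import Data.List.Relation.Unary.Any as Any
open import Data.List.Relation.Unary.Any.Properties
  using (mapMaybe⁺; deduplicate⁺; filter⁺; map⁺; lookup-result)
import Data.List.Relation.Unary.Unique.Setoid as Unique
import Data.List.Relation.Unary.Unique.DecSetoid.Properties as UniqueProperties
open import Data.Maybe.Base using (Maybe; just; nothing)
open import Data.Maybe.Relation.Unary.Any using (just) renaming (Any to MaybeAny)
open import Data.Nat using (ℕ; zero; suc; _+_; _∸_; _≤_; _⊓_; z≤n; s≤s)
open import Data.Nat.ListAction using (sum)
open import Data.Nat.Properties
open import Data.Product using (∃; ∃₂; _×_; _,_; proj₁; proj₂)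
open import Data.Sum using (_⊎_; inj₁; inj₂; [_,_]′)
import Data.Sum as Sum
open import Data.Vec.Base using ([]; _∷_; here; there; lookup; tabulate)
open import Data.Vec.Properties
  using (≡-dec; lookup∘tabulate; lookup⇒[]=; []=⇒lookup)
open import Function using (_∘_; id)
open import Function.Bundles using (mk⇔; Equivalence)
open import Level using (0ℓ)
open import Relation.Binary.Bundles using (Setoid; DecSetoid)
open import Relation.Binary.Definitions using (DecidableEquality; tri<; tri≈; tri>)
open import Relation.Binary.PropositionalEquality hiding (resp)
open import Relation.Nullary using (¬_; Dec; yes; no; does; proof; contradiction)
open import Relation.Nullary.Reflects using (Reflects; invert)
open import Relation.Nullary.Decidable using (dec-true; dec-false; ¬?; _⊎-dec_; _×-dec_)

private
  variable
    n : ℕ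
    A B : Subset n

-- Finite subsets and their cardinalities.

infix 4 _≟ˢ_
_≟ˢ_ : DecidableEquality (Subset n)
_≟ˢ_ = ≡-dec _≟ᵇ_

∣⁅x⁆∪p∣≡1+∣p∣ : ∀ {x : Fin n} {p} → x ∉ p → ∣ ⁅ x ⁆ ∪ p ∣ ≡ suc ∣ p ∣
∣⁅x⁆∪p∣≡1+∣p∣ {x = zero}  {inside  ∷ p} x∉p = contradiction here x∉p
∣⁅x⁆∪p∣≡1+∣p∣ {x = zero}  {outside ∷ p} x∉p = cong (suc ∘ ∣_∣) (∪-identityˡ p)
∣⁅x⁆∪p∣≡1+∣p∣ {x = suc x} {inside  ∷ p} x∉p = cong suc (∣⁅x⁆∪p∣≡1+∣p∣ (x∉p ∘ there))
∣⁅x⁆∪p∣≡1+∣p∣ {x = suc x} {outside ∷ p} x∉p = ∣⁅x⁆∪p∣≡1+∣p∣ (x∉p ∘ there)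

∣p∣≡1+k⇒p≡⁅x⁆∪q : ∀ (p : Subset n) {k} → ∣ p ∣ ≡ suc k →
                  ∃₂ λ x q → x ∉ q × p ≡ ⁅ x ⁆ ∪ q × ∣ q ∣ ≡ k
∣p∣≡1+k⇒p≡⁅x⁆∪q (inside ∷ p) eq =
  zero , outside ∷ p , (λ ()) , cong (inside ∷_) (sym (∪-identityˡ p)) , suc-injective eq
∣p∣≡1+k⇒p≡⁅x⁆∪q (outside ∷ p) eq with ∣p∣≡1+k⇒p≡⁅x⁆∪q p eq
... | x , q , x∉q , refl , ∣q∣≡k = suc x , outside ∷ q , x∉q ∘ drop-there , refl , ∣q∣≡k

∣p∣≡0⇒p≡⊥ : ∀ (p : Subset n) → ∣ p ∣ ≡ 0 → p ≡ ⊥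
∣p∣≡0⇒p≡⊥ []            _  = refl
∣p∣≡0⇒p≡⊥ (outside ∷ p) eq = cong (outside ∷_) (∣p∣≡0⇒p≡⊥ p eq)

∣p∣≡1⇒p≡⁅x⁆ : ∀ (p : Subset n) → ∣ p ∣ ≡ 1 → ∃ λ x → p ≡ ⁅ x ⁆
∣p∣≡1⇒p≡⁅x⁆ p eq with ∣p∣≡1+k⇒p≡⁅x⁆∪q p eq
... | x , q , _ , refl , ∣q∣≡0 =
  x , trans (cong (⁅ x ⁆ ∪_) (∣p∣≡0⇒p≡⊥ q ∣q∣≡0)) (∪-identityʳ ⁅ x ⁆)

Distinct : (x y z : Fin n) → Set
Distinct x y z = x ≢ y × y ≢ z × x ≢ z

∣p∣≡3⇒p≡⁅x,y,z⁆ : ∀ (p : Subset n) → ∣ p ∣ ≡ 3 → ∃ λ x → ∃₂ λ y z →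
                  p ≡ ⁅ x ⁆ ∪ ⁅ y ⁆ ∪ ⁅ z ⁆ × Distinct x y z
∣p∣≡3⇒p≡⁅x,y,z⁆ p eq with ∣p∣≡1+k⇒p≡⁅x⁆∪q p eq
... | x , q , x∉q , refl , ∣q∣≡2 with ∣p∣≡1+k⇒p≡⁅x⁆∪q q ∣q∣≡2
...   | y , r , y∉r , refl , ∣r∣≡1 with ∣p∣≡1⇒p≡⁅x⁆ r ∣r∣≡1
...     | z , refl =
  x , y , z , refl ,
  x∉⁅y⁆⇒x≢y (x∉q ∘ x∈p∪q⁺ ∘ inj₁) , x∉⁅y⁆⇒x≢y y∉r , x∉⁅y⁆⇒x≢y (x∉q ∘ x∈p∪q⁺ ∘ inj₂)

∈-triple : ∀ {t x y z : Fin n} → t ∈ ⁅ x ⁆ ∪ ⁅ y ⁆ ∪ ⁅ z ⁆ → t ≡ x ⊎ t ≡ y ⊎ t ≡ z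
∈-triple t∈ = Sum.map (x∈⁅y⁆⇒x≡y _) (Sum.map (x∈⁅y⁆⇒x≡y _) (x∈⁅y⁆⇒x≡y _) ∘ x∈p∪q⁻ _ _)
                      (x∈p∪q⁻ _ _ t∈)

⊆∧∣≥∣⇒≡ : A ⊆ B → ∣ B ∣ ≤ ∣ A ∣ → A ≡ B
⊆∧∣≥∣⇒≡ {A = A} {B} A⊆B ∣B∣≤∣A∣ = ⊆-antisym A⊆B B⊆A
  where
  B⊆A : B ⊆ A
  B⊆A {x} x∈B with x ∈? A
  ... | yes x∈A = x∈A
  ... | no  x∉A = contradiction (p⊂q⇒∣p∣<∣q∣ (A⊆B , x , x∈B , x∉A)) (≤⇒≯ ∣B∣≤∣A∣)

subsets : ∀ n → List (Subset n)
subsets zero    = [] ∷ []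
subsets (suc n) = map (outside ∷_) (subsets n) ++ map (inside ∷_) (subsets n)

∈-subsets : (p : Subset n) → p ∈ˡ subsets n
∈-subsets []            = here refl
∈-subsets (outside ∷ p) = ∈-++⁺ˡ (∈-map⁺ _ (∈-subsets p))
∈-subsets (inside  ∷ p) = ∈-++⁺ʳ _ (∈-map⁺ _ (∈-subsets p))

-- Splits

right≡∁left : (S : Split n) → right S ≡ ∁ (left S)
right≡∁left S = ⊆-antisym
  (λ x∈r → x∉p⇒x∈∁p λ x∈l → disjoint S (_ , x∈p∩q⁺ (x∈l , x∈r)))
  (λ x∈∁l → [ (λ x∈l → contradiction x∈l (x∈∁p⇒x∉p x∈∁l)) , id ]′
              (x∈p∪q⁻ (left S) (right S) (subst (_ ∈_) (sym (cover S)) ∈⊤)))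

left≡∁right : (S : Split n) → left S ≡ ∁ (right S)
left≡∁right S = sym (trans (cong ∁ (right≡∁left S)) (¬-involutive (left S)))
  where open import Algebra.Lattice.Properties.BooleanAlgebra (∪-∩-booleanAlgebra _) using (¬-involutive)

part≢⇒∁ : (S : Split n) → A PartOf S → B PartOf S → A ≢ B → B ≡ ∁ A
part≢⇒∁ S (inj₁ refl) (inj₁ refl) A≢B = contradiction refl A≢B
part≢⇒∁ S (inj₁ refl) (inj₂ refl) A≢B = right≡∁left S
part≢⇒∁ S (inj₂ refl) (inj₁ refl) A≢B = left≡∁right S
part≢⇒∁ S (inj₂ refl) (inj₂ refl) A≢B = contradiction refl A≢B

-- The other part is the complement of the shared one, so it is shared as well, on the same or on
-- the swapped side.
part-determines : (S S′ : Split n) → A PartOf S → A PartOf S′ → S ≈ˢ S′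
part-determines S S′ (inj₁ refl) (inj₁ l≡l′) =
  inj₁ (l≡l′ , trans (right≡∁left S) (trans (cong ∁ l≡l′) (sym (right≡∁left S′))))
part-determines S S′ (inj₁ refl) (inj₂ l≡r′) =
  inj₂ (l≡r′ , trans (right≡∁left S) (trans (cong ∁ l≡r′) (sym (left≡∁right S′))))
part-determines S S′ (inj₂ refl) (inj₁ r≡l′) =
  inj₂ (trans (left≡∁right S) (trans (cong ∁ r≡l′) (sym (right≡∁left S′))) , r≡l′)
part-determines S S′ (inj₂ refl) (inj₂ r≡r′) =
  inj₁ (trans (left≡∁right S) (trans (cong ∁ r≡r′) (sym (left≡∁right S′))) , r≡r′)

split : ∀ (A : Subset n) {x y} → x ∈ A → y ∉ A → Split n
split A x∈A y∉A = record
  { left           = A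
  ; right          = ∁ A
  ; left-nonempty  = _ , x∈A
  ; right-nonempty = _ , x∉p⇒x∈∁p y∉A
  ; disjoint       = λ (_ , z∈) → let z∈A , z∈∁A = x∈p∩q⁻ A _ z∈ in x∈∁p⇒x∉p z∈∁A z∈A
  ; cover          = p∪∁p≡⊤ A
  }

≈ˢ-sym : {S S′ : Split n} → S ≈ˢ S′ → S′ ≈ˢ S
≈ˢ-sym (inj₁ (ll , rr)) = inj₁ (sym ll , sym rr)
≈ˢ-sym (inj₂ (lr , rl)) = inj₂ (sym rl , sym lr)

≈ˢ-trans : {S S′ S″ : Split n} → S ≈ˢ S′ → S′ ≈ˢ S″ → S ≈ˢ S″
≈ˢ-trans (inj₁ (p , q)) (inj₁ (r , s)) = inj₁ (trans p r , trans q s)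
≈ˢ-trans (inj₁ (p , q)) (inj₂ (r , s)) = inj₂ (trans p r , trans q s)
≈ˢ-trans (inj₂ (p , q)) (inj₁ (r , s)) = inj₂ (trans p s , trans q r)
≈ˢ-trans (inj₂ (p , q)) (inj₂ (r , s)) = inj₁ (trans p s , trans q r)

infix 4 _≈ˢ?_
_≈ˢ?_ : (S S′ : Split n) → Dec (S ≈ˢ S′)
S ≈ˢ? S′ = (left S ≟ˢ left S′ ×-dec right S ≟ˢ right S′)
     ⊎-dec (left S ≟ˢ right S′ ×-dec right S ≟ˢ left S′)

-- Counting disagreements by sums over lists.

δ : Subset n → Subset n → ℕ
δ A B = if does (A ≟ˢ B) then 0 else 1

δ≡0 : A ≡ B → δ A B ≡ 0
δ≡0 {A = A} {B} A≡B rewrite dec-true (A ≟ˢ B) A≡B = refl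

δ≡1 : A ≢ B → δ A B ≡ 1
δ≡1 {A = A} {B} A≢B rewrite dec-false (A ≟ˢ B) A≢B = refl

δ≡0⁻ : δ A B ≡ 0 → A ≡ B
δ≡0⁻ {A = A} {B} eq with A ≟ˢ B
... | yes A≡B = A≡B
... | no  A≢B = contradiction eq λ ()

δ-triangle : (A B C : Subset n) → δ A C ≤ δ A B + δ B C
δ-triangle A B C with A ≟ˢ B
... | yes refl = ≤-refl
... | no  _ with A ≟ˢ C
...   | yes _ = z≤n
...   | no  _ = s≤s z≤n

δ-between : ∀ (A B C : Subset n) → B ≡ A ⊎ B ≡ C → δ A C ≡ δ A B + δ B C
δ-between A _ C (inj₁ refl) = sym (cong (_+ δ A C) (δ≡0 {A = A} refl))
δ-between A _ C (inj₂ refl) =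
  sym (trans (cong (δ A C +_) (δ≡0 {A = C} refl)) (+-identityʳ (δ A C)))

module _ {X : Set} where

  ∑ : (X → ℕ) → List X → ℕ
  ∑ f xs = sum (map f xs)

  private
    variable
      f g : X → ℕ

  ∑-+ : ∀ f g xs → ∑ (λ x → f x + g x) xs ≡ ∑ f xs + ∑ g xs
  ∑-+ f g []       = refl
  ∑-+ f g (x ∷ xs) = begin
    f x + g x + ∑ (λ x → f x + g x) xs ≡⟨ cong (f x + g x +_) (∑-+ f g xs) ⟩
    f x + g x + (∑ f xs + ∑ g xs)      ≡⟨ +-assoc (f x) (g x) _ ⟩
    f x + (g x + (∑ f xs + ∑ g xs))    ≡⟨ cong (f x +_) (x∙yz≈y∙xz (g x) (∑ f xs) _) ⟩
    f x + (∑ f xs + (g x + ∑ g xs))    ≡⟨ +-assoc (f x) _ _ ⟨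
    f x + ∑ f xs + (g x + ∑ g xs)      ∎
    where
    open ≡-Reasoning
    open import Algebra.Properties.CommutativeSemigroup +-commutativeSemigroup using (x∙yz≈y∙xz)

  ∑-mono : (∀ x → f x ≤ g x) → ∀ xs → ∑ f xs ≤ ∑ g xs
  ∑-mono f≤g []       = z≤n
  ∑-mono f≤g (x ∷ xs) = +-mono-≤ (f≤g x) (∑-mono f≤g xs)

  -- A term with `f x` below `g x` could not be made up for by the others. This turns an equality of
  -- distances into an equality on each split.
  ∑-tight : (∀ x → f x ≤ g x) → ∀ xs → ∑ g xs ≤ ∑ f xs → All (λ x → f x ≡ g x) xs
  ∑-tight f≤g [] _ = []
  ∑-tight {f} {g} f≤g (x ∷ xs) ∑g≤∑f =
    ≤-antisym (f≤g x) (+-cancelʳ-≤ (∑ g xs) (g x) (f x)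
      (≤-trans ∑g≤∑f (+-monoʳ-≤ (f x) (∑-mono f≤g xs)))) ∷
    ∑-tight f≤g xs (+-cancelˡ-≤ (g x) _ _
      (≤-trans ∑g≤∑f (+-monoˡ-≤ (∑ f xs) (f≤g x))))

  ∑-zero : ∀ {xs} → All (λ x → f x ≡ 0) xs → ∑ f xs ≡ 0
  ∑-zero []         = refl
  ∑-zero (eq ∷ eqs) = cong₂ _+_ eq (∑-zero eqs)

  ∑-zero⁻ : ∀ xs → ∑ f xs ≡ 0 → All (λ x → f x ≡ 0) xs
  ∑-zero⁻ []       _  = []
  ∑-zero⁻ (x ∷ xs) eq = m+n≡0⇒m≡0 _ eq ∷ ∑-zero⁻ xs (m+n≡0⇒n≡0 _ eq)

module _ (𝕊 : Setoid 0ℓ 0ℓ) where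

  open Setoid 𝕊 renaming (sym to ≈-sym; trans to ≈-trans)

  -- Only an entry equivalent to `s` contributes; membership provides one and uniqueness up to `_≈_`
  -- excludes a second.
  ∑-indicator : ∀ {f : Carrier → ℕ} {s} →
                (∀ x → x ≈ s → f x ≡ 1) → (∀ x → ¬ x ≈ s → f x ≡ 0) →
                ∀ {xs} → Unique.Unique 𝕊 xs → Any (s ≈_) xs → ∑ f xs ≡ 1
  ∑-indicator f≡1 f≡0 (x≉xs ∷ _) (here s≈x) =
    cong₂ _+_ (f≡1 _ (≈-sym s≈x))
              (∑-zero (All.map (λ x≉y → f≡0 _ λ y≈s → x≉y (≈-sym (≈-trans y≈s s≈x))) x≉xs))
  ∑-indicator f≡1 f≡0 (x≉xs ∷ unique) (there s∈xs) =
    cong₂ _+_ (f≡0 _ λ x≈s → All.lookupWith (λ x≉y s≈y → x≉y (≈-trans x≈s s≈y)) x≉xs s∈xs)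
              (∑-indicator f≡1 f≡0 unique s∈xs)

-- Medians in the Buneman graph

data TwoOf {X : Set} (P : X → Set) (x y z : X) : Set where
  xy : P x → P y → TwoOf P x y z
  yz : P y → P z → TwoOf P x y z
  xz : P x → P z → TwoOf P x y z

module _ {X : Set} {P Q : X → Set} {x y z : X} where

  -- Two pairs chosen from three positions overlap. This pigeonhole is behind (B2) for the majority
  -- vertex and behind the separation criterion.
  TwoOf-common : TwoOf P x y z → TwoOf Q x y z → ∃ λ t → P t × Q t
  TwoOf-common (xy px py) (xy qx qy) = x , px , qx
  TwoOf-common (xy px py) (yz qy qz) = y , py , qy
  TwoOf-common (xy px py) (xz qx qz) = x , px , qx
  TwoOf-common (yz py pz) (xy qx qy) = y , py , qy
  TwoOf-common (yz py pz) (yz qy qz) = y , py , qy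
  TwoOf-common (yz py pz) (xz qx qz) = z , pz , qz
  TwoOf-common (xz px pz) (xy qx qy) = x , px , qx
  TwoOf-common (xz px pz) (yz qy qz) = z , pz , qz
  TwoOf-common (xz px pz) (xz qx qz) = x , px , qx

  TwoOf-map : (∀ {t} → P t → Q t) → TwoOf P x y z → TwoOf Q x y z
  TwoOf-map h (xy px py) = xy (h px) (h py)
  TwoOf-map h (yz py pz) = yz (h py) (h pz)
  TwoOf-map h (xz px pz) = xz (h px) (h pz)

TwoOf-some : ∀ {X : Set} {P : X → Set} {x y z} → TwoOf P x y z → ∃ P
TwoOf-some two = let t , p , _ = TwoOf-common two two in t , p

module Medians (𝒮 : SplitSystem n) where

  open Buneman 𝒮 hiding (Injective)

  private
    variable
      u v : Vertex

  -- Enumeration of the splits of a system.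

  elementSetoid : DecSetoid _ _
  elementSetoid = record
    { Carrier = Element
    ; _≈_     = _≈ᵉ_
    ; isDecEquivalence = record
      { isEquivalence = record
        { refl  = inj₁ (refl , refl)
        ; sym   = λ {S} {S′} → ≈ˢ-sym {S = proj₁ S} {proj₁ S′}
        ; trans = λ {S} {S′} {S″} → ≈ˢ-trans {S = proj₁ S} {proj₁ S′} {proj₁ S″}
        }
      ; _≟_ = λ S S′ → proj₁ S ≈ˢ? proj₁ S′
      }
    }

  open DecSetoid elementSetoid
    renaming (_≟_ to _≈ᵉ?_; refl to ≈ᵉ-refl; sym to ≈ᵉ-sym; trans to ≈ᵉ-trans; setoid to 𝔼)
    using ()

  -- A split is determined by either part, so running through all subsets `A` reaches every member
  -- up to `_≈ᵉ_`, in the normal form with right part `∁ A`.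
  elementOn : Subset n → Maybe Element
  elementOn A with nonempty? A | nonempty? (∁ A)
  ... | no _          | _             = nothing
  ... | yes _         | no _          = nothing
  ... | yes (_ , x∈A) | yes (_ , y∈∁A)
    with member? 𝒮 (split A x∈A (x∈∁p⇒x∉p y∈∁A))
  ...   | yes S∈𝒮 = just (_ , S∈𝒮)
  ...   | no  _   = nothing

  elementOn-left : (S : Element) → MaybeAny (S ≈ᵉ_) (elementOn (left (proj₁ S)))
  elementOn-left (S , S∈𝒮) with nonempty? (left S) | nonempty? (∁ (left S))
  ... | no empty      | _             = contradiction (left-nonempty S) empty
  ... | yes _         | no empty      =
    contradiction (subst Nonempty (right≡∁left S) (right-nonempty S)) empty
  ... | yes (_ , x∈A) | yes (_ , y∈∁A)
    with member? 𝒮 (split (left S) x∈A (x∈∁p⇒x∉p y∈∁A))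
  ...   | yes _   = just (inj₁ (refl , right≡∁left S))
  ...   | no  S∉𝒮 = contradiction (resp 𝒮 (inj₁ (refl , right≡∁left S)) S∈𝒮) S∉𝒮

  -- Both parts of a split produce it, so the list is deduplicated; otherwise `dist` would count
  -- every split twice.
  elements : List Element
  elements = deduplicate _≈ᵉ?_ (mapMaybe elementOn (subsets n))

  elements-complete : ∀ S → Any (S ≈ᵉ_) elements
  elements-complete S = deduplicate⁺ _≈ᵉ?_
    (λ {T} {T′} T′≈T S≈T → ≈ᵉ-trans {S} {T} {T′} S≈T (≈ᵉ-sym {T′} {T} T′≈T))
    (mapMaybe⁺ elementOn (subsets n)
      (map⁺ (lose (∈-subsets (left (proj₁ S))) (elementOn-left S))))

  elements-unique : Unique.Unique 𝔼 elements
  elements-unique = UniqueProperties.deduplicate-! elementSetoid _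

  -- The graph distance as the number of splits on which two vertices differ.

  dist : Vertex → Vertex → ℕ
  dist u v = ∑ (λ S → δ (ϕ u S) (ϕ v S)) elements

  dist-triangle : ∀ u m v → dist u v ≤ dist u m + dist m v
  dist-triangle u m v = ≤-trans
    (∑-mono (λ S → δ-triangle (ϕ u S) (ϕ m S) (ϕ v S)) elements)
    (≤-reflexive (∑-+ _ _ elements))

  Between : Vertex → Vertex → Vertex → Set
  Between u v m = ∀ S → ϕ m S ≡ ϕ u S ⊎ ϕ m S ≡ ϕ v S

  dist-between : ∀ u m v → Between u v m → dist u v ≡ dist u m + dist m v
  dist-between u m v between = trans
    (cong sum (map-cong (λ S → δ-between (ϕ u S) (ϕ m S) (ϕ v S) (between S)) elements))
    (∑-+ _ _ elements)

  -- The list holds one representative of each class, so a property checked on it is carried to all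
  -- elements by invariance under `_≈ᵉ_`.
  everywhere : (P : Element → Set) → (∀ {S T} → S ≈ᵉ T → P T → P S) → All P elements → ∀ S → P S
  everywhere P P-resp all S = All.lookupWith (λ p S≈T → P-resp S≈T p) all (elements-complete S)

  agree-resp : ∀ u v {S T} → S ≈ᵉ T → ϕ u T ≡ ϕ v T → ϕ u S ≡ ϕ v S
  agree-resp u v S≈T eq = trans (ϕ-cong u S≈T) (trans eq (sym (ϕ-cong v S≈T)))

  dist≡0⇒≈ : ∀ u v → dist u v ≡ 0 → u ≈ᵛ v
  dist≡0⇒≈ u v eq = everywhere (λ S → ϕ u S ≡ ϕ v S) (agree-resp u v)
    (All.map δ≡0⁻ (∑-zero⁻ elements eq))

  ≈⇒dist≡0 : ∀ u v → u ≈ᵛ v → dist u v ≡ 0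
  ≈⇒dist≡0 u v u≈v = ∑-zero {xs = elements} (All.universal (λ S → δ≡0 (u≈v S)) elements)

  adjacent⇒dist≡1 : ∀ u v → Adjacent u v → dist u v ≡ 1
  adjacent⇒dist≡1 u v (S , u≢v , unique) = ∑-indicator 𝔼 {s = S}
    (λ T T≈S → δ≡1 λ eq → u≢v (agree-resp u v (≈ᵉ-sym {T} {S} T≈S) eq))
    (λ T T≉S → δ≡0 (agree T T≉S))
    elements-unique (elements-complete S)
    where
    agree : ∀ T → ¬ T ≈ᵉ S → ϕ u T ≡ ϕ v T
    agree T T≉S with ϕ u T ≟ˢ ϕ v T
    ... | yes eq = eq
    ... | no neq = contradiction (unique T neq) T≉S

  -- Each edge accounts for one disagreement, and the triangle inequality adds these up along the
  -- walk.
  dist≤length : ∀ {k} → Walk k u v → dist u v ≤ k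
  dist≤length {u} {v} (stop u≈v) = ≤-reflexive (≈⇒dist≡0 u v u≈v)
  dist≤length {u} {v} (step {v = w} adj walk) = ≤-trans (dist-triangle u w v)
    (+-mono-≤ (≤-reflexive (adjacent⇒dist≡1 u w adj)) (dist≤length walk))

  -- Switching u to v on a single split S respects (B2) when ϕ u S is minimal: if the new value
  -- ϕ v S = X − ϕ u S missed ϕ u T, then ϕ u T ⊆ ϕ u S, so T = S.
  module Switch (u v : Vertex) (S : Element) (u≢v : ϕ u S ≢ ϕ v S)
    (minimal : ∀ T → ϕ u T ≢ ϕ v T → ∣ ϕ u S ∣ ≤ ∣ ϕ u T ∣) where

    switchϕ : Element → Subset n
    switchϕ T with T ≈ᵉ? S
    ... | yes _ = ϕ v T
    ... | no  _ = ϕ u T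

    on : ∀ T → T ≈ᵉ S → switchϕ T ≡ ϕ v T
    on T T≈S with T ≈ᵉ? S
    ... | yes _   = refl
    ... | no  T≉S = contradiction T≈S T≉S

    off : ∀ T → ¬ T ≈ᵉ S → switchϕ T ≡ ϕ u T
    off T T≉S with T ≈ᵉ? S
    ... | yes T≈S = contradiction T≈S T≉S
    ... | no  _   = refl

    switch-part : ∀ T → switchϕ T PartOf proj₁ T
    switch-part T with T ≈ᵉ? S
    ... | yes _ = part v T
    ... | no  _ = part u T

    switch-cong : ∀ {T T′} → T ≈ᵉ T′ → switchϕ T ≡ switchϕ T′
    switch-cong {T} {T′} T≈T′ with T ≈ᵉ? S
    ... | yes T≈S = trans (ϕ-cong v T≈T′)
      (sym (on T′ (≈ᵉ-trans {T′} {T} {S} (≈ᵉ-sym {T} {T′} T≈T′) T≈S)))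
    ... | no  T≉S = trans (ϕ-cong u T≈T′)
      (sym (off T′ (T≉S ∘ ≈ᵉ-trans {T} {T′} {S} T≈T′)))

    meets-off : ∀ T → ¬ T ≈ᵉ S → Nonempty (ϕ v S ∩ ϕ u T)
    meets-off T T≉S with ϕ u T ≟ˢ ϕ v T
    -- Where `u` and `v` agree on `T`, (B2) for `v` suffices; minimality enters only where they
    -- differ.
    ... | yes eq = subst (λ A → Nonempty (ϕ v S ∩ A)) (sym eq)
                     (meets v S T (T≉S ∘ ≈ᵉ-sym {S} {T}))
    ... | no neq with nonempty? (ϕ v S ∩ ϕ u T)
    ...   | yes nonempty = nonempty
    ...   | no  empty    = contradiction
      (part-determines (proj₁ T) (proj₁ S) (part u T)
        (subst (_PartOf proj₁ S) (sym (⊆∧∣≥∣⇒≡ uT⊆uS (minimal T neq))) (part u S)))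
      T≉S
      where
      uT⊆uS : ϕ u T ⊆ ϕ u S
      uT⊆uS x∈uT = subst (_ ∈_) (sym (part≢⇒∁ (proj₁ S) (part v S) (part u S) (u≢v ∘ sym)))
        (x∉p⇒x∈∁p λ x∈vS → empty (_ , x∈p∩q⁺ (x∈vS , x∈uT)))

    meets-mixed : ∀ T T′ → T ≈ᵉ S → ¬ T′ ≈ᵉ S → Nonempty (ϕ v T ∩ ϕ u T′)
    meets-mixed T T′ T≈S T′≉S =
      subst (λ A → Nonempty (A ∩ ϕ u T′)) (sym (ϕ-cong v T≈S)) (meets-off T′ T′≉S)

    switch-meets : ∀ T T′ → ¬ T ≈ᵉ T′ → Nonempty (switchϕ T ∩ switchϕ T′)
    switch-meets T T′ T≉T′ with T ≈ᵉ? S | T′ ≈ᵉ? S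
    ... | yes _   | yes _    = meets v T T′ T≉T′
    ... | no _    | no _     = meets u T T′ T≉T′
    ... | yes T≈S | no T′≉S  = meets-mixed T T′ T≈S T′≉S
    ... | no T≉S  | yes T′≈S = subst Nonempty (∩-comm (ϕ v T′) (ϕ u T)) (meets-mixed T′ T T′≈S T≉S)

    switch : Vertex
    switch = record
      { ϕ = switchϕ ; ϕ-cong = λ {T} {T′} → switch-cong {T} {T′}
      ; part = switch-part ; meets = switch-meets }

    switch-adjacent : Adjacent u switch
    switch-adjacent = S , (λ eq → u≢v (trans eq (on S (≈ᵉ-refl {S})))) , unique
      where
      unique : ∀ T → ϕ u T ≢ switchϕ T → T ≈ᵉ S
      unique T neq with T ≈ᵉ? S
      ... | yes T≈S = T≈S
      ... | no  T≉S = contradiction refl neq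

    switch-between : Between u v switch
    switch-between T with T ≈ᵉ? S
    ... | yes _ = inj₂ refl
    ... | no  _ = inj₁ refl

  -- Among the splits on which `u` and `v` differ, one with the smallest `ϕ u S` can be switched to
  -- its value under `v`. The result is a neighbour of `u` lying between `u` and `v`, hence one step
  -- closer to `v`.
  approach : ∀ u v → dist u v ≢ 0 → ∃ λ w → Adjacent u w × dist u v ≡ suc (dist w v)
  approach u v dist≢0 with Any.any? (λ S → ¬? (ϕ u S ≟ˢ ϕ v S)) elements
  ... | no none = contradiction
    (∑-zero (All.tabulate λ {S} S∈ → δ≡0 (agree S S∈)))
    dist≢0
    where
    agree : ∀ S → S ∈ˡ elements → ϕ u S ≡ ϕ v S
    agree S S∈ with ϕ u S ≟ˢ ϕ v S
    ... | yes eq = eq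
    ... | no neq = contradiction (lose S∈ neq) none
  ... | yes some = switch , switch-adjacent ,
    trans (dist-between u switch v switch-between)
          (cong (_+ dist switch v) (adjacent⇒dist≡1 u switch switch-adjacent))
    where
    differ? = λ S → ¬? (ϕ u S ≟ˢ ϕ v S)
    differing = filter differ? elements
    -- The default value is itself a split on which `u` and `v` differ, so the minimiser is one
    -- whether it is the default or comes from the list.
    S = argmin (λ S → ∣ ϕ u S ∣) (Any.lookup some) differing

    u≢v : ϕ u S ≢ ϕ v S
    u≢v = argmin-all (λ S → ∣ ϕ u S ∣) {P = λ S → ϕ u S ≢ ϕ v S}
      (lookup-result some) (all-filter differ? elements)

    minimal : ∀ T → ϕ u T ≢ ϕ v T → ∣ ϕ u S ∣ ≤ ∣ ϕ u T ∣
    minimal T neq with filter⁺ differ? (elements-complete T)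
    -- The list contains an element `R` equivalent to `T` rather than `T` itself; `ϕ u` takes the
    -- same value on both.
    ... | inj₁ T∈ = All.lookupWith
      (λ le T≈R → ≤-trans le (≤-reflexive (cong ∣_∣ (sym (ϕ-cong u T≈R)))))
      (f[argmin]≤f[xs] (Any.lookup some) differing) T∈
    ... | inj₂ same = contradiction
      (λ eq → neq (agree-resp u v (lookup-result (elements-complete T)) eq)) same

    open Switch u v S u≢v minimal

  -- Iterating `approach` gives a walk as short as `dist≤length` permits, so `dist` is the graph
  -- distance.
  geodesic : ∀ k u v → dist u v ≡ k → Walk k u v
  geodesic zero    u v eq = stop (dist≡0⇒≈ u v eq)
  geodesic (suc k) u v eq with approach u v (λ eq′ → 0≢1+n (trans (sym eq′) eq))
  ... | w , adj , eq′ = step adj (geodesic k w v (suc-injective (trans (sym eq′) eq)))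

  between⇒onShortestPath : ∀ u v m → Between u v m → OnShortestPath u v m
  between⇒onShortestPath u v m between =
    dist u m , dist m v , geodesic _ u m refl , geodesic _ m v refl ,
    λ j walk → subst (_≤ j) (dist-between u m v between) (dist≤length walk)

  -- A geodesic bounds `k + l` by `dist u v`, so the triangle inequality through `m` is an equality
  -- in total and hence on every split. Where `u` and `v` agree, both summands on the right are then
  -- zero.
  onShortestPath⇒agree : ∀ u v m → OnShortestPath u v m →
                         ∀ S → ϕ u S ≡ ϕ v S → ϕ u S ≡ ϕ m S
  onShortestPath⇒agree u v m (k , l , walk , walk′ , shortest) = everywhere
    (λ S → ϕ u S ≡ ϕ v S → ϕ u S ≡ ϕ m S)
    (λ {S} {T} S≈T h eq → agree-resp u m S≈T (h (agree-resp u v (≈ᵉ-sym {S} {T} S≈T) eq)))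
    (All.map (λ {S} eq u≡v → δ≡0⁻ (m+n≡0⇒m≡0 _ (trans (sym eq) (δ≡0 u≡v)))) tight)
    where
    tight : All (λ S → δ (ϕ u S) (ϕ v S) ≡ δ (ϕ u S) (ϕ m S) + δ (ϕ m S) (ϕ v S)) elements
    tight = ∑-tight (λ S → δ-triangle (ϕ u S) (ϕ m S) (ϕ v S)) elements (begin
      _                       ≡⟨ ∑-+ _ _ elements ⟩
      dist u m + dist m v     ≤⟨ +-mono-≤ (dist≤length walk) (dist≤length walk′) ⟩
      k + l                   ≤⟨ shortest _ (geodesic _ u v refl) ⟩
      dist u v                ∎)
      where open ≤-Reasoning

  -- The median as the majority vertex.

  module _ (x y z : Fin n) where

    -- A split has only two parts, so `z` casts the deciding vote when `x` and `y` lie in different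
    -- ones.
    majorityϕ : Element → Subset n
    majorityϕ (S , _) = if does (S ⟦ x ⟧ ≟ˢ S ⟦ y ⟧) then S ⟦ x ⟧ else S ⟦ z ⟧

    majorityϕ-two : ∀ S → TwoOf (λ t → proj₁ S ⟦ t ⟧ ≡ majorityϕ S) x y z
    majorityϕ-two (S , _) with S ⟦ x ⟧ ≟ˢ S ⟦ y ⟧ | S ⟦ z ⟧ ≟ˢ S ⟦ y ⟧
    ... | yes x≡y | _       = xy refl (sym x≡y)
    ... | no  x≢y | yes z≡y = yz (sym z≡y) refl
    -- Both `x` and `z` lie in the complement of the part containing `y`.
    ... | no  x≢y | no  z≢y = xz (trans
      (part≢⇒∁ S (⟦⟧-part S y) (⟦⟧-part S x) (x≢y ∘ sym))
      (sym (part≢⇒∁ S (⟦⟧-part S y) (⟦⟧-part S z) (z≢y ∘ sym)))) refl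

    -- Two of the three lie in `A` and two in the majority part; a common one lies in both, and an
    -- element determines its part.
    majorityϕ-unique : ∀ S → A PartOf proj₁ S → TwoOf (_∈ A) x y z → A ≡ majorityϕ S
    majorityϕ-unique S A∈S two with TwoOf-common two (majorityϕ-two S)
    ... | t , t∈A , eq = trans (⟦⟧-unique (proj₁ S) t A∈S t∈A) eq

    majority-members : ∀ S → TwoOf (_∈ majorityϕ S) x y z
    majority-members S =
      TwoOf-map (λ {t} eq → subst (t ∈_) eq (∈⟦⟧ (proj₁ S) t)) (majorityϕ-two S)

    majority-part : ∀ S → majorityϕ S PartOf proj₁ S
    majority-part S with TwoOf-some (majorityϕ-two S)
    ... | t , eq = subst (_PartOf proj₁ S) eq (⟦⟧-part (proj₁ S) t)

    majority : Vertex
    majority = record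
      { ϕ      = majorityϕ
      ; ϕ-cong = λ {S} {S′} S≈S′ → majorityϕ-unique S′
          (PartOf-resp {S = proj₁ S} {proj₁ S′} S≈S′ (majority-part S)) (majority-members S)
      ; part   = majority-part
      -- Each value contains two of `x`, `y`, `z`, so the two values share one of them.
      ; meets  = λ S S′ _ →
          let t , t∈S , t∈S′ = TwoOf-common (majority-members S) (majority-members S′)
          in t , x∈p∩q⁺ (t∈S , t∈S′)
      }

    -- Any two of `x`, `y`, `z` include a member of the majority, so on every split the value agrees
    -- with one end of each pair.
    majority-isMedian : IsMedian ϕ[ x ] ϕ[ y ] ϕ[ z ] majority
    majority-isMedian =
      between⇒onShortestPath ϕ[ x ] ϕ[ y ] majority (λ S → case-xy (majorityϕ-two S)) ,
      between⇒onShortestPath ϕ[ y ] ϕ[ z ] majority (λ S → case-yz (majorityϕ-two S)) ,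
      between⇒onShortestPath ϕ[ x ] ϕ[ z ] majority (λ S → case-xz (majorityϕ-two S))
      where
      module _ {B : Subset n} {f : Fin n → Subset n} where
        case-xy : TwoOf (λ t → f t ≡ B) x y z → B ≡ f x ⊎ B ≡ f y
        case-xy (xy x≡ _) = inj₁ (sym x≡)
        case-xy (yz y≡ _) = inj₂ (sym y≡)
        case-xy (xz x≡ _) = inj₁ (sym x≡)

        case-yz : TwoOf (λ t → f t ≡ B) x y z → B ≡ f y ⊎ B ≡ f z
        case-yz (xy _ y≡) = inj₁ (sym y≡)
        case-yz (yz y≡ _) = inj₁ (sym y≡)
        case-yz (xz _ z≡) = inj₂ (sym z≡)

        case-xz : TwoOf (λ t → f t ≡ B) x y z → B ≡ f x ⊎ B ≡ f z
        case-xz (xy x≡ _) = inj₁ (sym x≡)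
        case-xz (yz _ z≡) = inj₂ (sym z≡)
        case-xz (xz x≡ _) = inj₁ (sym x≡)

    -- On each split two of the three vertices agree with the majority, and a vertex on a shortest
    -- path between those two must share their value.
    median-unique : ∀ m → IsMedian ϕ[ x ] ϕ[ y ] ϕ[ z ] m → m ≈ᵛ majority
    median-unique m (via-xy , via-yz , via-xz) S with majorityϕ-two S
    ... | xy x≡ y≡ =
      trans (sym (onShortestPath⇒agree ϕ[ x ] ϕ[ y ] m via-xy S (trans x≡ (sym y≡)))) x≡
    ... | yz y≡ z≡ =
      trans (sym (onShortestPath⇒agree ϕ[ y ] ϕ[ z ] m via-yz S (trans y≡ (sym z≡)))) y≡
    ... | xz x≡ z≡ =
      trans (sym (onShortestPath⇒agree ϕ[ x ] ϕ[ z ] m via-xz S (trans x≡ (sym z≡)))) x≡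

    majority-isMedianOf : ∀ {Y} → Y ≡ ⁅ x ⁆ ∪ ⁅ y ⁆ ∪ ⁅ z ⁆ → IsMedianOf Y majority
    majority-isMedianOf Y≡ = x , y , z , Y≡ , majority-isMedian , median-unique

  -- A criterion for two medians to differ.

  Separated : (x y z x′ y′ z′ : Fin n) → Set
  Separated x y z x′ y′ z′ = ∃₂ λ S A →
    Member 𝒮 S × A PartOf S × TwoOf (_∈ A) x y z × TwoOf (_∉ A) x′ y′ z′

  -- The first median takes the value `A` on `S`. If the second did too, `A` would contain two of
  -- `x′`, `y′`, `z′` while missing two.
  separated⇒≉ : ∀ {x y z x′ y′ z′} → Separated x y z x′ y′ z′ →
                ¬ (majority x y z ≈ᵛ majority x′ y′ z′)
  separated⇒≉ {x} {y} {z} {x′} {y′} {z′} (S , A , S∈𝒮 , A∈S , two , two′) eq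
    with TwoOf-common two′ (majority-members x′ y′ z′ (S , S∈𝒮))
  ... | t , t∉A , t∈ = t∉A (subst (t ∈_)
    (sym (trans (majorityϕ-unique x y z (S , S∈𝒮) A∈S two) (eq (S , S∈𝒮)))) t∈)

  -- The caller chooses how to list the elements of each triple, which later permits listing them in
  -- cyclic position order. Either direction of separation shows that the medians differ.
  separated⇒injective :
    (∀ Y Y′ → ∣ Y ∣ ≡ 3 → ∣ Y′ ∣ ≡ 3 → Y ≢ Y′ →
       ∃ λ x → ∃₂ λ y z → ∃ λ x′ → ∃₂ λ y′ z′ →
       Y ≡ ⁅ x ⁆ ∪ ⁅ y ⁆ ∪ ⁅ z ⁆ × Y′ ≡ ⁅ x′ ⁆ ∪ ⁅ y′ ⁆ ∪ ⁅ z′ ⁆ ×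
       (Separated x y z x′ y′ z′ ⊎ Separated x′ y′ z′ x y z)) →
    Injective 𝒮
  separated⇒injective separate Y Y′ ∣Y∣≡3 ∣Y′∣≡3 Y≢Y′ with separate Y Y′ ∣Y∣≡3 ∣Y′∣≡3 Y≢Y′
  ... | x , y , z , x′ , y′ , z′ , Y≡ , Y′≡ , sep =
    majority x y z , majority x′ y′ z′ ,
    majority-isMedianOf x y z Y≡ , majority-isMedianOf x′ y′ z′ Y′≡ ,
    [ separated⇒≉ , (λ sep′ eq → separated⇒≉ sep′ (sym ∘ eq)) ]′ sep

open Medians using (Separated; separated⇒injective)

-- Systems containing all 2-splits

module TwoSplits (4≤n : 4 ≤ n) (𝒮 : SplitSystem n) (twoSplits : Contains2Splits 𝒮) where

  module _ {x y z x′ y′ z′ : Fin n} where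

    separate-pair : ∀ {p q} → Distinct x′ y′ z′ → p ≢ q → p ∉ ⁅ x′ ⁆ ∪ ⁅ y′ ⁆ ∪ ⁅ z′ ⁆ →
                    TwoOf (_∈ (⁅ p ⁆ ∪ ⁅ q ⁆)) x y z → Separated 𝒮 x y z x′ y′ z′
    separate-pair {p} {q} (x′≢y′ , y′≢z′ , x′≢z′) p≢q p∉Y′ two =
      split pq (proj₂ (TwoOf-some two)) (proj₂ (TwoOf-some outside-two)) , pq ,
      -- The size is the minimum of 2 and `n ∸ 2`, and `4 ≤ n` makes this 2.
      twoSplits _ (trans (cong₂ _⊓_ ∣pq∣≡2 (∣∁p∣≡n∸∣p∣ pq))
        (trans (cong (λ k → 2 ⊓ (n ∸ k)) ∣pq∣≡2) (m≤n⇒m⊓n≡m (∸-monoˡ-≤ 2 4≤n)))) ,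
      inj₁ refl , two , outside-two
      where
      pq = ⁅ p ⁆ ∪ ⁅ q ⁆

      ∣pq∣≡2 : ∣ pq ∣ ≡ 2
      ∣pq∣≡2 = trans (∣⁅x⁆∪p∣≡1+∣p∣ (x≢y⇒x∉⁅y⁆ p≢q)) (cong suc (∣⁅x⁆∣≡1 q))

      ∉pq : ∀ {t} → t ∈ ⁅ x′ ⁆ ∪ ⁅ y′ ⁆ ∪ ⁅ z′ ⁆ → t ≢ q → t ∉ pq
      ∉pq t∈Y′ t≢q t∈pq with x∈p∪q⁻ ⁅ p ⁆ ⁅ q ⁆ t∈pq
      ... | inj₁ t∈p = p∉Y′ (subst (_∈ _) (x∈⁅y⁆⇒x≡y p t∈p) t∈Y′)
      ... | inj₂ t∈q = t≢q (x∈⁅y⁆⇒x≡y q t∈q)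

      x′∈ = x∈p∪q⁺ {q = ⁅ y′ ⁆ ∪ ⁅ z′ ⁆} (inj₁ (x∈⁅x⁆ x′))
      y′∈ = x∈p∪q⁺ {p = ⁅ x′ ⁆} (inj₂ (x∈p∪q⁺ {q = ⁅ z′ ⁆} (inj₁ (x∈⁅x⁆ y′))))
      z′∈ = x∈p∪q⁺ {p = ⁅ x′ ⁆} (inj₂ (x∈p∪q⁺ {p = ⁅ y′ ⁆} (inj₂ (x∈⁅x⁆ z′))))

      outside-two : TwoOf (_∉ pq) x′ y′ z′
      outside-two with x′ ≟ᶠ q | y′ ≟ᶠ q
      -- By distinctness at most one of `x′`, `y′`, `z′` is `q`, and none is `p`; two others are
      -- picked.
      ... | yes x≡q | _       = yz (∉pq y′∈ (λ y≡q → x′≢y′ (trans x≡q (sym y≡q))))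
                                 (∉pq z′∈ (λ z≡q → x′≢z′ (trans x≡q (sym z≡q))))
      ... | no  x≢q | yes y≡q = xz (∉pq x′∈ x≢q)
                                 (∉pq z′∈ (λ z≡q → y′≢z′ (trans y≡q (sym z≡q))))
      ... | no  x≢q | no  y≢q = xy (∉pq x′∈ x≢q) (∉pq y′∈ y≢q)

  private
    ∈ˡ : ∀ (p q : Fin n) → p ∈ ⁅ p ⁆ ∪ ⁅ q ⁆
    ∈ˡ p q = x∈p∪q⁺ (inj₁ (x∈⁅x⁆ p))

    ∈ʳ : ∀ (p q : Fin n) → q ∈ ⁅ p ⁆ ∪ ⁅ q ⁆
    ∈ʳ p q = x∈p∪q⁺ {p = ⁅ p ⁆} (inj₂ (x∈⁅x⁆ q))

  -- A pair {p , q} ⊆ Y with p ∉ Y′ contains at most one element of Y′.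
  twoSplits⇒injective : Injective 𝒮
  twoSplits⇒injective = separated⇒injective 𝒮 separate
    where
    separate : ∀ Y Y′ → ∣ Y ∣ ≡ 3 → ∣ Y′ ∣ ≡ 3 → Y ≢ Y′ → _
    separate Y Y′ ∣Y∣≡3 ∣Y′∣≡3 Y≢Y′
      with ∣p∣≡3⇒p≡⁅x,y,z⁆ Y ∣Y∣≡3 | ∣p∣≡3⇒p≡⁅x,y,z⁆ Y′ ∣Y′∣≡3
    ... | x , y , z , refl , x≢y , y≢z , x≢z | x′ , y′ , z′ , refl , distinct′ =
      x , y , z , x′ , y′ , z′ , refl , refl , inj₁ separated
      where
      separated : Separated 𝒮 x y z x′ y′ z′
      separated with x ∈? Y′ | y ∈? Y′ | z ∈? Y′
      ... | no x∉ | _     | _     = separate-pair distinct′ x≢y x∉ (xy (∈ˡ x y) (∈ʳ x y))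
      ... | yes _ | no y∉ | _     = separate-pair distinct′ y≢z y∉ (yz (∈ˡ y z) (∈ʳ y z))
      ... | yes _ | yes _ | no z∉ =
        separate-pair distinct′ (x≢z ∘ sym) z∉ (xz (∈ʳ z x) (∈ˡ z x))
      -- Here `Y` lies in `Y′`, and equal cardinalities force equality.
      ... | yes x∈ | yes y∈ | yes z∈ = contradiction
        (⊆∧∣≥∣⇒≡ Y⊆Y′ (≤-reflexive (trans ∣Y′∣≡3 (sym ∣Y∣≡3)))) Y≢Y′
        where
        Y⊆Y′ : Y ⊆ Y′
        Y⊆Y′ t∈Y with ∈-triple t∈Y
        ... | inj₁ refl        = x∈
        ... | inj₂ (inj₁ refl) = y∈
        ... | inj₂ (inj₂ refl) = z∈

-- Maximal circular systems

module Intervals (π : Permutation′ n) where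

  open import Algebra.Bundles using (CommutativeMonoid)
  open import Algebra.Properties.CommutativeSemigroup
    (CommutativeMonoid.commutativeSemigroup (∪-commutativeMonoid n))
    using (x∙yz≈x∙zy; x∙yz≈z∙xy; x∙yz≈y∙xz; x∙yz≈y∙zx; x∙yz≈z∙yx)

  pos : Fin n → Fin n
  pos = π ⟨$⟩ˡ_

  pos-injective : ∀ {x y} → pos x ≡ pos y → x ≡ y
  pos-injective eq = trans (sym (inverseʳ π)) (trans (cong (π ⟨$⟩ʳ_) eq) (inverseʳ π))

  within? : ∀ (i j x : Fin n) → Dec (i ≤ᶠ pos x × pos x ≤ᶠ j)
  within? i j x = i ≤ᶠ? pos x ×-dec pos x ≤ᶠ? j

  interval : Fin n → Fin n → Subset n
  interval i j = tabulate (does ∘ within? i j)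

  ∈-interval⁺ : ∀ i j {x} → i ≤ᶠ pos x × pos x ≤ᶠ j → x ∈ interval i j
  ∈-interval⁺ i j {x} within = lookup⇒[]= x _
    (trans (lookup∘tabulate _ x) (dec-true (within? i j x) within))

  ∈-interval⁻ : ∀ i j {x} → x ∈ interval i j → i ≤ᶠ pos x × pos x ≤ᶠ j
  ∈-interval⁻ i j {x} x∈ = invert (subst (Reflects _)
    (trans (sym (lookup∘tabulate _ x)) ([]=⇒lookup x∈)) (proof (within? i j x)))

  interval-isInterval : ∀ i j → IsInterval π i j (interval i j)
  interval-isInterval i j k = mk⇔
    (subst (λ l → i ≤ᶠ l × l ≤ᶠ j) (inverseˡ π) ∘ ∈-interval⁻ i j)
    (∈-interval⁺ i j ∘ subst (λ l → i ≤ᶠ l × l ≤ᶠ j) (sym (inverseˡ π)))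

  isInterval⇒≡ : ∀ {i j A} → IsInterval π i j A → A ≡ interval i j
  isInterval⇒≡ {i} {j} {A} isInterval = ⊆-antisym
    (λ {x} x∈A → ∈-interval⁺ i j (Equivalence.to (isInterval (pos x))
                   (subst (_∈ A) (sym (inverseʳ π)) x∈A)))
    (λ {x} x∈I → subst (_∈ A) (inverseʳ π)
                   (Equivalence.from (isInterval (pos x)) (∈-interval⁻ i j x∈I)))

  singleton≡interval : ∀ x → ⁅ x ⁆ ≡ interval (pos x) (pos x)
  singleton≡interval x = ⊆-antisym
    (λ t∈ → subst (_∈ _) (sym (x∈⁅y⁆⇒x≡y x t∈)) (∈-interval⁺ (pos x) (pos x) (≤-refl , ≤-refl)))
    (λ t∈ → let x≤t , t≤x = ∈-interval⁻ (pos x) (pos x) t∈ in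
      subst (_∈ ⁅ x ⁆) (pos-injective (≤ᶠ-antisym x≤t t≤x)) (x∈⁅x⁆ x))

  IsIntervalSplit : Split n → Set
  IsIntervalSplit S = ∃₂ λ i j → i ≤ᶠ j × interval i j PartOf S

  intervalSystem : SplitSystem n
  intervalSystem = record
    { Member  = IsIntervalSplit
    ; member? = λ S → any? λ i → any? λ j → i ≤ᶠ? j ×-dec
        (interval i j ≟ˢ left S ⊎-dec interval i j ≟ˢ right S)
    ; resp    = λ {S} {S′} S≈S′ (i , j , i≤j , I∈S) →
        i , j , i≤j , PartOf-resp {S = S} {S′} S≈S′ I∈S
    -- The minimum of the two sizes is attained, so some part is a singleton, which is a one-point
    -- interval.
    ; trivial = λ S size≡1 →
        [ (λ eq → singleton S (inj₁ refl) (trans (sym eq) size≡1))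
        , (λ eq → singleton S (inj₂ refl) (trans (sym eq) size≡1)) ]′
        (⊓-sel ∣ left S ∣ ∣ right S ∣)
    }
    where
    singleton : ∀ S {A} → A PartOf S → ∣ A ∣ ≡ 1 → IsIntervalSplit S
    singleton S {A} A∈S ∣A∣≡1 with ∣p∣≡1⇒p≡⁅x⁆ A ∣A∣≡1
    ... | x , refl = pos x , pos x , ≤-refl , subst (_PartOf S) (singleton≡interval x) A∈S

  intervalSystem-circular : Circular intervalSystem
  intervalSystem-circular = π , λ S (i , j , i≤j , I∈S) →
    i , j , i≤j , interval i j , I∈S , interval-isInterval i j

  -- Sorting triples by position and separating them by intervals.

  Increasing : (x y z : Fin n) → Set
  Increasing x y z = pos x <ᶠ pos y × pos y <ᶠ pos z

  -- The union ignores the order of its elements, and injectivity of `pos` rules out ties.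
  sort : ∀ {x y z} → Distinct x y z → ∃ λ x′ → ∃₂ λ y′ z′ →
         ⁅ x ⁆ ∪ ⁅ y ⁆ ∪ ⁅ z ⁆ ≡ ⁅ x′ ⁆ ∪ ⁅ y′ ⁆ ∪ ⁅ z′ ⁆ × Increasing x′ y′ z′
  sort {x} {y} {z} (x≢y , y≢z , x≢z)
    with <ᶠ-cmp (pos x) (pos y) | <ᶠ-cmp (pos y) (pos z) | <ᶠ-cmp (pos x) (pos z)
  ... | tri≈ _ x≡y _ | _            | _            = contradiction (pos-injective x≡y) x≢y
  ... | _            | tri≈ _ y≡z _ | _            = contradiction (pos-injective y≡z) y≢z
  ... | _            | _            | tri≈ _ x≡z _ = contradiction (pos-injective x≡z) x≢z
  ... | tri< x<y _ _ | tri< y<z _ _ | _            = x , y , z , refl , x<y , y<z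
  ... | tri< x<y _ _ | tri> _ _ z<y | tri< x<z _ _ = x , z , y , x∙yz≈x∙zy _ _ _ , x<z , z<y
  ... | tri< x<y _ _ | tri> _ _ z<y | tri> _ _ z<x = z , x , y , x∙yz≈z∙xy _ _ _ , z<x , x<y
  ... | tri> _ _ y<x | tri< y<z _ _ | tri< x<z _ _ = y , x , z , x∙yz≈y∙xz _ _ _ , y<x , x<z
  ... | tri> _ _ y<x | tri< y<z _ _ | tri> _ _ z<x = y , z , x , x∙yz≈y∙zx _ _ _ , y<z , z<x
  ... | tri> _ _ y<x | tri> _ _ z<y | _            = z , y , x , x∙yz≈z∙yx _ _ _ , z<y , y<x

  module _ (𝒮 : SplitSystem n) (intervals : ∀ S → IsIntervalSplit S → Member 𝒮 S) where

    -- The elements within make the interval nonempty and give `i ≤ᶠ j`; those beyond make its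
    -- complement nonempty. So it is a part of an interval split.
    separate-interval : ∀ i j {x y z x′ y′ z′} →
      TwoOf (λ t → i ≤ᶠ pos t × pos t ≤ᶠ j) x y z →
      TwoOf (λ t → pos t <ᶠ i ⊎ j <ᶠ pos t) x′ y′ z′ → Separated 𝒮 x y z x′ y′ z′
    separate-interval i j within beyond =
      split (interval i j) (∈-interval⁺ i j (i≤t , t≤j)) (proj₂ (TwoOf-some excluded)) , interval i j ,
      intervals _ (i , j , ≤-trans i≤t t≤j , inj₁ refl) , inj₁ refl ,
      TwoOf-map (∈-interval⁺ i j) within , excluded
      where
      i≤t = proj₁ (proj₂ (TwoOf-some within))
      t≤j = proj₂ (proj₂ (TwoOf-some within))

      beyond⇒∉ : ∀ {t} → pos t <ᶠ i ⊎ j <ᶠ pos t → t ∉ interval i j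
      beyond⇒∉ (inj₁ t<i) t∈ = <⇒≱ t<i (proj₁ (∈-interval⁻ i j t∈))
      beyond⇒∉ (inj₂ j<t) t∈ = <⇒≱ j<t (proj₂ (∈-interval⁻ i j t∈))

      excluded = TwoOf-map beyond⇒∉ beyond

    -- If the middle elements differ, the interval from the first to the middle element of the
    -- triple with the earlier middle separates.  Otherwise an interval ending or starting at
    -- the common middle element does.
    separate-increasing : ∀ {x y z x′ y′ z′} → Increasing x y z → Increasing x′ y′ z′ →
      ⁅ x ⁆ ∪ ⁅ y ⁆ ∪ ⁅ z ⁆ ≢ ⁅ x′ ⁆ ∪ ⁅ y′ ⁆ ∪ ⁅ z′ ⁆ →
      Separated 𝒮 x y z x′ y′ z′ ⊎ Separated 𝒮 x′ y′ z′ x y z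
    separate-increasing {x} {y} {z} {x′} {y′} {z′} (x<y , y<z) (x′<y′ , y′<z′) Y≢Y′
      with <ᶠ-cmp (pos y) (pos y′)
    ... | tri< y<y′ _ _ = inj₁ (separate-interval (pos x) (pos y)
      (xy (≤-refl , <⇒≤ x<y) (<⇒≤ x<y , ≤-refl))
      (yz (inj₂ y<y′) (inj₂ (<-trans y<y′ y′<z′))))
    ... | tri> _ _ y′<y = inj₂ (separate-interval (pos x′) (pos y′)
      (xy (≤-refl , <⇒≤ x′<y′) (<⇒≤ x′<y′ , ≤-refl))
      (yz (inj₂ y′<y) (inj₂ (<-trans y′<y y<z))))
    ... | tri≈ _ y≡y′ _ with pos-injective y≡y′
    ...   | refl with <ᶠ-cmp (pos x) (pos x′) | <ᶠ-cmp (pos z) (pos z′)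
    -- The shorter of the two intervals from a first element to the common middle is taken: it
    -- misses the earlier first element and the last element of the same triple.
    ...     | tri< x<x′ _ _ | _ = inj₂ (separate-interval (pos x′) (pos y)
      (xy (≤-refl , <⇒≤ x′<y′) (<⇒≤ x′<y′ , ≤-refl))
      (xz (inj₁ x<x′) (inj₂ y<z)))
    ...     | tri> _ _ x′<x | _ = inj₁ (separate-interval (pos x) (pos y)
      (xy (≤-refl , <⇒≤ x<y) (<⇒≤ x<y , ≤-refl))
      (xz (inj₁ x′<x) (inj₂ y′<z′)))
    -- With equal first elements, the interval from the middle to the earlier last element misses
    -- both ends of the other triple.
    ...     | tri≈ _ _ _ | tri< z<z′ _ _ = inj₁ (separate-interval (pos y) (pos z)
      (yz (≤-refl , <⇒≤ y<z) (<⇒≤ y<z , ≤-refl))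
      (xz (inj₁ x′<y′) (inj₂ z<z′)))
    ...     | tri≈ _ _ _ | tri> _ _ z′<z = inj₂ (separate-interval (pos y) (pos z′)
      (yz (≤-refl , <⇒≤ y′<z′) (<⇒≤ y′<z′ , ≤-refl))
      (xz (inj₁ x<y) (inj₂ z′<z)))
    ...     | tri≈ _ x≡x′ _ | tri≈ _ z≡z′ _ = contradiction
      (cong₂ (λ x z → ⁅ x ⁆ ∪ ⁅ y ⁆ ∪ ⁅ z ⁆) (pos-injective x≡x′) (pos-injective z≡z′)) Y≢Y′

    intervals⇒injective : Injective 𝒮
    intervals⇒injective = separated⇒injective 𝒮 separate
      where
      separate : ∀ Y Y′ → ∣ Y ∣ ≡ 3 → ∣ Y′ ∣ ≡ 3 → Y ≢ Y′ → _
      separate Y Y′ ∣Y∣≡3 ∣Y′∣≡3 Y≢Y′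
        with ∣p∣≡3⇒p≡⁅x,y,z⁆ Y ∣Y∣≡3 | ∣p∣≡3⇒p≡⁅x,y,z⁆ Y′ ∣Y′∣≡3
      ... | _ , _ , _ , Y≡ , distinct | _ , _ , _ , Y′≡ , distinct′
        with sort distinct | sort distinct′
      ... | x , y , z , eq , increasing | x′ , y′ , z′ , eq′ , increasing′ =
        x , y , z , x′ , y′ , z′ , trans Y≡ eq , trans Y′≡ eq′ ,
        separate-increasing increasing increasing′ λ same →
          Y≢Y′ (trans (trans Y≡ eq) (trans same (sym (trans Y′≡ eq′))))

-- All interval splits for the labelling of `𝒮` form a circular system containing `𝒮`. An interval
-- split missing from `𝒮` would make the inclusion strict, against maximality.
maximal⇒intervals : (𝒮 : SplitSystem n) (((π , _) , _) : MaximalCircular 𝒮) →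
                    ∀ S → Intervals.IsIntervalSplit π S → Member 𝒮 S
maximal⇒intervals 𝒮 ((π , circular) , maximal) S S-interval with member? 𝒮 S
... | yes S∈𝒮 = S∈𝒮
... | no  S∉𝒮 = contradiction
  (intervalSystem , intervalSystem-circular , (λ {T} → ⊆intervalSystem T) ,
   λ ⊆𝒮 → S∉𝒮 (⊆𝒮 {S} S-interval))
  maximal
  where
  open Intervals π

  ⊆intervalSystem : ∀ T → Member 𝒮 T → IsIntervalSplit T
  ⊆intervalSystem T T∈𝒮 with circular T T∈𝒮
  ... | i , j , i≤j , A , A∈T , isInterval =
    i , j , i≤j , subst (_PartOf T) (isInterval⇒≡ isInterval) A∈T

theorem1 : (n : ℕ) → 4 ≤ n → (𝒮 : SplitSystem n) →
    (Contains2Splits 𝒮 → Injective 𝒮) × (MaximalCircular 𝒮 → Injective 𝒮)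
theorem1 n 4≤n 𝒮 =
  TwoSplits.twoSplits⇒injective 4≤n 𝒮 ,
  λ maximal@((π , _) , _) →
    Intervals.intervals⇒injective π 𝒮 (maximal⇒intervals 𝒮 maximal)
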